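{- Let $a,b,m,N,M\in\mathbb{N}$ with $b\mid a$, $m=a+b$ and $N\le M$. For $j\ge0$ set $A_j:=a+jm$ and $B_j:=b+jm$, and let $$\mathcal{E}_{N,M}:=\{1,2,\ldots,N+M-1\}\setminus\{1,3,5,\ldots,2N-1\}.$$ Then $$g_{a,b,m}(N,M;q)=\prod_{j=0}^{N-1}R_{A_j,B_j}(q)\;\times\prod_{r\in\mathcal{E}_{N,M}}(1+q^{rm})\;\prod_{j=N}^{M-1}\frac{1}{1-q^{B_j}}.$$
   Context: $\mathbb{N}$ is the set of positive integers. Notation: $(z;q)_n=\prod_{i=0}^{n-1}(1-zq^i)$. For $a,b,m,N,M\in\mathbb{N}$, $$g_{a,b,m}(N,M;q):=\frac{(-q^m;q^m)_{N+M-1}}{(-q^a;q^m)_N\,(q^b;q^m)_M}.$$ For $A,B\in\mathbb{N}$, $$R_{A,B}(q):=\frac{1+q^{A+B}}{(1+q^A)(1-q^B)}.$$ Quotients are expanded as formal power series in $q$; empty products equal $1$. -}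

module Defs where

open import Algebra.Bundles.Raw using (RawRing)
open import Data.Fin.Base using (toℕ)
import Data.Integer as ℤ
import Data.Integer.Properties as ℤ
open import Data.List.Base using (List; applyUpTo; filter; foldr; upTo)
open import Data.Nat as ℕ using (ℕ; zero; suc; _∸_)
open import Level using (0ℓ)
open import Relation.Binary.PropositionalEquality using (_≗_)

open import Algebra.Properties.Semiring.Sum ℤ.+-*-semiring using (sum⁺-syntax)
open import Data.List.Membership.DecPropositional ℕ._≟_ using (_∉?_)

infix  4 _≈_
infix  8 -_
infixl 7 _*_ _/_
infixl 6 _+_ _-_

-- The ring ℤ[[q]]: f n is the coefficient of qⁿ in f.
PowerSeries : Set
PowerSeries = ℕ → ℤ.ℤ

_≈_ : PowerSeries → PowerSeries → Set
_≈_ = _≗_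

0# 1# q : PowerSeries

0# _ = ℤ.0ℤ

1# zero    = ℤ.1ℤ
1# (suc _) = ℤ.0ℤ

q zero          = ℤ.0ℤ
q (suc zero)    = ℤ.1ℤ
q (suc (suc _)) = ℤ.0ℤ

_+_ : PowerSeries → PowerSeries → PowerSeries
(f + g) n = f n ℤ.+ g n

-_ : PowerSeries → PowerSeries
(- f) n = ℤ.- f n

_-_ : PowerSeries → PowerSeries → PowerSeries
f - g = f + (- g)

_*_ : PowerSeries → PowerSeries → PowerSeries
(f * g) n = ∑[ i ≤ n ] (f (toℕ i) ℤ.* g (n ∸ toℕ i))

powerSeriesRawRing : RawRing 0ℓ 0ℓ
powerSeriesRawRing = record
  { Carrier = PowerSeries
  ; _≈_     = _≈_
  ; _+_     = _+_
  ; _*_     = _*_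
  ; -_      = -_
  ; 0#      = 0#
  ; 1#      = 1#
  }

open import Algebra.Definitions.RawSemiring (RawRing.rawSemiring powerSeriesRawRing) public using (_^_)

-- 1/f = Σ_{k≥0} (1 - f)ᵏ when f has constant term 1.  Then 1 - f has constant
-- term 0, so the terms with k > n do not contribute to the coefficient of qⁿ.
-- The value is meaningless for other f, but every denominator used below,
-- at positive parameters, has constant term 1.
recip : PowerSeries → PowerSeries
recip f n = ∑[ k ≤ n ] ((1# - f) ^ toℕ k) n

_/_ : PowerSeries → PowerSeries → PowerSeries
f / g = f * recip g

-- Every index list used below is free of repetitions, so this is a product
-- over the underlying finite set.
∏ : List ℕ → (ℕ → PowerSeries) → PowerSeries
∏ is f = foldr (λ i p → f i * p) 1# is

syntax ∏ is (λ i → f) = ∏[ i ∈ is ] f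

-- The integers i with s ≤ i < t.
range : ℕ → ℕ → List ℕ
range s t = applyUpTo (s ℕ.+_) (t ∸ s)

-- (z; t)ₙ
poch : PowerSeries → PowerSeries → ℕ → PowerSeries
poch z t n = ∏[ i ∈ upTo n ] (1# - z * t ^ i)

g : (a b m N M : ℕ) → PowerSeries
g a b m N M =
  poch (- (q ^ m)) (q ^ m) (N ℕ.+ M ∸ 1) /
  (poch (- (q ^ a)) (q ^ m) N * poch (q ^ b) (q ^ m) M)

R : (A B : ℕ) → PowerSeries
R A B = (1# + q ^ (A ℕ.+ B)) / ((1# + q ^ A) * (1# - q ^ B))

-- {1, 2, …, N+M-1} ∖ {1, 3, …, 2N-1}
𝓔 : (N M : ℕ) → List ℕ
𝓔 N M = filter (_∉? applyUpTo (λ j → 2 ℕ.* j ℕ.+ 1) N) (range 1 (N ℕ.+ M))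

{-# OPTIONS --safe #-}
module Submission where

-- As m = a + b, we have A_j + B_j = (2j+1)m, so the numerators of the R_{A_j,B_j}
-- are the factors of (-q^m; q^m)_{N+M-1} with odd index r ≤ 2N-1, and the
-- remaining factors are those with r ∈ 𝓔.  A quotient by a series with constant
-- term 1 is characterised by its product with the denominator, so it suffices
-- to multiply the right-hand side by (-q^a; q^m)_N (q^b; q^m)_M.

open import Algebra.Bundles using (CommutativeMonoid; CommutativeRing)
import Algebra.Construct.Pointwise as Pointwise
import Algebra.Properties.CommutativeSemigroup as CommutativeSemigroupProperties
import Algebra.Properties.Ring as RingProperties
import Algebra.Properties.Semiring.Exp as Exp
import Algebra.Solver.CommutativeMonoid as CommutativeMonoidSolver
open import Data.Fin.Base using (toℕ)
import Data.Integer as ℤ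
import Data.Integer.Properties as ℤ
open import Data.Integer.Tactic.RingSolver using (solve-∀)
open import Data.List.Base using (List; []; _∷_; _++_; applyUpTo; filter; foldr; upTo)
open import Data.List.Membership.Propositional using (_∈_)
open import Data.List.Membership.Propositional.Properties
  using (∈-++⁺ˡ; ∈-++⁺ʳ; ∈-++⁻; ∈-applyUpTo⁺; ∈-applyUpTo⁻; ∈-filter⁺; ∈-filter⁻)
open import Data.List.Membership.Propositional.Properties.WithK using (unique∧set⇒bag)
open import Data.List.Properties using (foldr-map; map-upTo)
open import Data.List.Relation.Binary.BagAndSetEquality using (∼bag⇒↭)
open import Data.List.Relation.Binary.Permutation.Propositional as ↭ using (_↭_)
open import Data.List.Relation.Unary.Unique.Propositional using (Unique)
import Data.List.Relation.Unary.Unique.Propositional.Properties as Unique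
open import Data.Nat as ℕ using (ℕ; zero; suc; _∸_; NonZero; _≤_; z≤n; s≤s)
open import Data.Nat.Divisibility using (_∣_)
import Data.Nat.Properties as ℕ
import Data.Nat.Tactic.RingSolver as ℕ-Solver
open import Data.Product using (_,_; proj₁; proj₂)
open import Data.Sum using ([_,_]′)
open import Function using (_∘_; mk⇔)
open import Level using (0ℓ)
open import Relation.Binary.PropositionalEquality as ≡ using (_≡_)
import Relation.Binary.Reasoning.Setoid as SetoidReasoning
open import Relation.Nullary using (yes; no)

open import Data.List.Membership.DecPropositional ℕ._≟_ using (_∈?_; _∉?_)

-- Finite products and cancellation in a commutative monoid.

-- Over an abstract monoid the operation is rigid, so implicit arguments can be
-- inferred; for power series it would unfold to a sum.
module CommutativeMonoidProduct {c ℓ} (M : CommutativeMonoid c ℓ) where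

  open CommutativeMonoid M
  open CommutativeSemigroupProperties commutativeSemigroup using (interchange; x∙yz≈y∙xz)
  open SetoidReasoning setoid

  ⨀ : List ℕ → (ℕ → Carrier) → Carrier
  ⨀ is f = foldr (λ i p → f i ∙ p) ε is

  ⨀-cong : ∀ is {f h} → (∀ i → f i ≈ h i) → ⨀ is f ≈ ⨀ is h
  ⨀-cong []       f≈h = refl
  ⨀-cong (i ∷ is) f≈h = ∙-cong (f≈h i) (⨀-cong is f≈h)

  ⨀-ε : ∀ is → ⨀ is (λ _ → ε) ≈ ε
  ⨀-ε []       = refl
  ⨀-ε (i ∷ is) = trans (identityˡ _) (⨀-ε is)

  ⨀-∙ : ∀ is f h → ⨀ is f ∙ ⨀ is h ≈ ⨀ is (λ i → f i ∙ h i)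
  ⨀-∙ []       f h = identityˡ ε
  ⨀-∙ (i ∷ is) f h = trans (interchange _ _ _ _) (∙-congˡ (⨀-∙ is f h))

  ⨀-++ : ∀ is js f → ⨀ (is ++ js) f ≈ ⨀ is f ∙ ⨀ js f
  ⨀-++ []       js f = sym (identityˡ _)
  ⨀-++ (i ∷ is) js f = trans (∙-congˡ (⨀-++ is js f)) (sym (assoc _ _ _))

  ⨀-↭ : ∀ {is js} f → is ↭ js → ⨀ is f ≈ ⨀ js f
  ⨀-↭ f ↭.refl          = refl
  ⨀-↭ f (↭.prep i p)    = ∙-congˡ (⨀-↭ f p)
  ⨀-↭ f (↭.swap i j p)  = trans (x∙yz≈y∙xz _ _ _) (∙-congˡ (∙-congˡ (⨀-↭ f p)))
  ⨀-↭ f (↭.trans p p′)  = trans (⨀-↭ f p) (⨀-↭ f p′)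

  ⨀-applyUpTo : ∀ (h : ℕ → ℕ) n f → ⨀ (applyUpTo h n) f ≡ ⨀ (upTo n) (f ∘ h)
  ⨀-applyUpTo h n f =
    ≡.trans (≡.cong (λ is → ⨀ is f) (≡.sym (map-upTo h n))) (foldr-map _ h ε (upTo n))

  cancel-inverse : ∀ x {y z} → y ∙ z ≈ ε → (x ∙ z) ∙ y ≈ x
  cancel-inverse x {y} {z} y∙z≈ε = begin
    (x ∙ z) ∙ y  ≈⟨ assoc x z y ⟩
    x ∙ (z ∙ y)  ≈⟨ ∙-congˡ (trans (comm z y) y∙z≈ε) ⟩
    x ∙ ε        ≈⟨ identityʳ x ⟩
    x            ∎

  -- With `z` as the inverse of `y`, this says that a quotient is determined by its product with the
  -- denominator.
  divide : ∀ {w x y z} → y ∙ z ≈ ε → w ∙ y ≈ x → x ∙ z ≈ w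
  divide {w} {x} {y} {z} y∙z≈ε w∙y≈x = begin
    x ∙ z        ≈⟨ ∙-congʳ w∙y≈x ⟨
    (w ∙ y) ∙ z  ≈⟨ assoc w y z ⟩
    w ∙ (y ∙ z)  ≈⟨ ∙-congˡ y∙z≈ε ⟩
    w ∙ ε        ≈⟨ identityʳ w ⟩
    w            ∎

  -- The bookkeeping of the final argument. `r`, `e`, `s` stand for the three products on the
  -- right-hand side and `x ∙ t` for the denominator of `g`. The factor `t` is split so that `r`
  -- absorbs `x` and `t₁`, while `s` is inverse to `t₂`.
  clear-denominators : ∀ {r e s x t t₁ t₂ n p} → t ≈ t₁ ∙ t₂ → r ∙ (x ∙ t₁) ≈ n →
                       s ∙ t₂ ≈ ε → n ∙ e ≈ p → ((r ∙ e) ∙ s) ∙ (x ∙ t) ≈ p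
  clear-denominators {r} {e} {s} {x} {t} {t₁} {t₂} {n} {p} t≈ r≈ s≈ n≈ = begin
    ((r ∙ e) ∙ s) ∙ (x ∙ t)            ≈⟨ ∙-congˡ (∙-congˡ t≈) ⟩
    ((r ∙ e) ∙ s) ∙ (x ∙ (t₁ ∙ t₂))    ≈⟨ solve 6 (λ r e s x t₁ t₂ →
                                            ((r ⊕ e) ⊕ s) ⊕ (x ⊕ (t₁ ⊕ t₂)) ⊜
                                            ((r ⊕ (x ⊕ t₁)) ⊕ e) ⊕ (s ⊕ t₂)) refl r e s x t₁ t₂ ⟩
    ((r ∙ (x ∙ t₁)) ∙ e) ∙ (s ∙ t₂)    ≈⟨ ∙-cong (trans (∙-congʳ r≈) n≈) s≈ ⟩
    p ∙ ε                              ≈⟨ identityʳ p ⟩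
    p                                  ∎
    where open CommutativeMonoidSolver M

-- Factors of q-Pochhammer symbols as single powers.

module CommutativeRingProperties {c ℓ} (R : CommutativeRing c ℓ) where

  open CommutativeRing R
  open RingProperties ring using (-‿distribˡ-*; -‿involutive)
  open Exp semiring using (_^_; ^-homo-*; ^-assocʳ)
  open SetoidReasoning setoid

  x^a*[x^m]^j : ∀ x a m j → x ^ a * (x ^ m) ^ j ≈ x ^ (a ℕ.+ j ℕ.* m)
  x^a*[x^m]^j x a m j = begin
    x ^ a * (x ^ m) ^ j      ≈⟨ *-congˡ (^-assocʳ x m j) ⟩
    x ^ a * x ^ (m ℕ.* j)    ≡⟨ ≡.cong (λ k → x ^ a * x ^ k) (ℕ.*-comm m j) ⟩
    x ^ a * x ^ (j ℕ.* m)    ≈⟨ ^-homo-* x a (j ℕ.* m) ⟨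
    x ^ (a ℕ.+ j ℕ.* m)      ∎

  1-x^a*[x^m]^j : ∀ x a m j → 1# + - (x ^ a * (x ^ m) ^ j) ≈ 1# + - x ^ (a ℕ.+ j ℕ.* m)
  1-x^a*[x^m]^j x a m j = +-congˡ (-‿cong (x^a*[x^m]^j x a m j))

  1+x^a*[x^m]^j : ∀ x a m j → 1# + - (- x ^ a * (x ^ m) ^ j) ≈ 1# + x ^ (a ℕ.+ j ℕ.* m)
  1+x^a*[x^m]^j x a m j = +-congˡ (begin
    - (- x ^ a * (x ^ m) ^ j)    ≈⟨ -‿cong (-‿distribˡ-* (x ^ a) ((x ^ m) ^ j)) ⟨
    - - (x ^ a * (x ^ m) ^ j)    ≈⟨ -‿involutive _ ⟩
    x ^ a * (x ^ m) ^ j          ≈⟨ x^a*[x^m]^j x a m j ⟩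
    x ^ (a ℕ.+ j ℕ.* m)          ∎)

-- Splitting index lists.

m+n≢0 : ∀ m n .{{_ : NonZero m}} → NonZero (m ℕ.+ n)
m+n≢0 (suc m) n = _

applyUpTo-++ : ∀ {a} {A : Set a} (f : ℕ → A) m n →
               applyUpTo f (m ℕ.+ n) ≡ applyUpTo f m ++ applyUpTo (f ∘ (m ℕ.+_)) n
applyUpTo-++ f zero    n = ≡.refl
applyUpTo-++ f (suc m) n = ≡.cong (f 0 ∷_) (applyUpTo-++ (f ∘ suc) m n)

-- Lists without repetitions that have the same members are equal as bags, hence permutations of
-- each other. The right-hand list has no repetitions because the filtered part is disjoint from
-- `ys`.
filter-∉-↭ : ∀ {xs ys} → Unique xs → Unique ys → (∀ {v} → v ∈ ys → v ∈ xs) →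
             xs ↭ ys ++ filter (_∉? ys) xs
filter-∉-↭ {xs} {ys} xs! ys! ys⊆xs =
  ∼bag⇒↭ (unique∧set⇒bag xs!
    (Unique.++⁺ ys! (Unique.filter⁺ (_∉? ys) xs!)
      λ (v∈ys , v∈filter) → proj₂ (∈-filter⁻ (_∉? ys) {xs = xs} v∈filter) v∈ys)
    (mk⇔ to from))
  where
  to : ∀ {v} → v ∈ xs → v ∈ ys ++ filter (_∉? ys) xs
  to {v} v∈xs with v ∈? ys
  ... | yes v∈ys = ∈-++⁺ˡ v∈ys
  ... | no  v∉ys = ∈-++⁺ʳ ys (∈-filter⁺ (_∉? ys) v∈xs v∉ys)
  from : ∀ {v} → v ∈ ys ++ filter (_∉? ys) xs → v ∈ xs
  from = [ ys⊆xs , proj₁ ∘ ∈-filter⁻ (_∉? ys) ]′ ∘ ∈-++⁻ ys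

open import Defs

open import Algebra.Properties.Semiring.Sum ℤ.+-*-semiring
  using (sum; sum-cong-≗)
open ≡ using (refl; sym; trans; cong; cong₂; module ≡-Reasoning)

-- The commutative ring of power series.

tail : PowerSeries → PowerSeries
tail f n = f (suc n)

infixl 7 _·_

_·_ : ℤ.ℤ → PowerSeries → PowerSeries
(c · f) n = c ℤ.* f n

-- The sum defining the product unfolds by computation to
--   tail (f * g) = f 0 · tail g + tail f * g,
-- so that the ring laws follow by induction on the exponent.

-- Only coefficients of `g` up to `n` enter the sum, so series that agree merely up to `n` can be
-- exchanged.
*-congʳ-≤ : ∀ f {g h} n → (∀ {i} → i ≤ n → g i ≡ h i) → (f * g) n ≡ (f * h) n
*-congʳ-≤ f n g≡h =
  sum-cong-≗ {suc n} λ i → cong (f (toℕ i) ℤ.*_) (g≡h (ℕ.m∸n≤m n (toℕ i)))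

*-cong : ∀ {f f′ g g′} → f ≈ f′ → g ≈ g′ → f * g ≈ f′ * g′
*-cong f≈f′ g≈g′ n =
  sum-cong-≗ {suc n} λ i → cong₂ ℤ._*_ (f≈f′ (toℕ i)) (g≈g′ (n ∸ toℕ i))

-- The mirror image of the recursion that holds by computation: the last term of the sum is split
-- off instead of the first. Commutativity follows by playing the two recursions against each other.
*-suc : ∀ f g n → (f * g) (suc n) ≡ (f * tail g) n ℤ.+ f (suc n) ℤ.* g 0
*-suc f g zero    = lemma (f 0) (f 1) (g 0) (g 1)
  where
  lemma : ∀ a b c d → a ℤ.* d ℤ.+ (b ℤ.* c ℤ.+ ℤ.0ℤ) ≡ a ℤ.* d ℤ.+ ℤ.0ℤ ℤ.+ b ℤ.* c
  lemma = solve-∀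
*-suc f g (suc n) = begin
  f 0 ℤ.* g (suc (suc n)) ℤ.+ (tail f * g) (suc n)
    ≡⟨ cong (ℤ._+_ (f 0 ℤ.* g (suc (suc n)))) (*-suc (tail f) g n) ⟩
  f 0 ℤ.* g (suc (suc n)) ℤ.+ ((tail f * tail g) n ℤ.+ f (suc (suc n)) ℤ.* g 0)
    ≡⟨ ℤ.+-assoc (f 0 ℤ.* g (suc (suc n))) ((tail f * tail g) n) _ ⟨
  (f * tail g) (suc n) ℤ.+ f (suc (suc n)) ℤ.* g 0 ∎
  where open ≡-Reasoning

*-comm : ∀ f g → f * g ≈ g * f
*-comm f g zero    = cong (ℤ._+ ℤ.0ℤ) (ℤ.*-comm (f 0) (g 0))
*-comm f g (suc n) = begin
  (f * g) (suc n)
    ≡⟨ *-suc f g n ⟩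
  (f * tail g) n ℤ.+ f (suc n) ℤ.* g 0
    ≡⟨ cong₂ ℤ._+_ (*-comm f (tail g) n) (ℤ.*-comm (f (suc n)) (g 0)) ⟩
  (tail g * f) n ℤ.+ g 0 ℤ.* f (suc n)
    ≡⟨ ℤ.+-comm ((tail g * f) n) _ ⟩
  (g * f) (suc n) ∎
  where open ≡-Reasoning

*-distribʳ-+ : ∀ h f g → (f + g) * h ≈ f * h + g * h
*-distribʳ-+ h f g zero = lemma (f 0) (g 0) (h 0)
  where
  lemma : ∀ a b c → (a ℤ.+ b) ℤ.* c ℤ.+ ℤ.0ℤ ≡ (a ℤ.* c ℤ.+ ℤ.0ℤ) ℤ.+ (b ℤ.* c ℤ.+ ℤ.0ℤ)
  lemma = solve-∀
*-distribʳ-+ h f g (suc n) =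
  trans (cong (ℤ._+_ ((f 0 ℤ.+ g 0) ℤ.* h (suc n))) (*-distribʳ-+ h (tail f) (tail g) n))
        (lemma (f 0) (g 0) (h (suc n)) ((tail f * h) n) ((tail g * h) n))
  where
  lemma : ∀ a b c d e →
          (a ℤ.+ b) ℤ.* c ℤ.+ (d ℤ.+ e) ≡ (a ℤ.* c ℤ.+ d) ℤ.+ (b ℤ.* c ℤ.+ e)
  lemma = solve-∀

·-*-assoc : ∀ c f g → (c · f) * g ≈ c · (f * g)
·-*-assoc c f g zero    = lemma c (f 0) (g 0)
  where
  lemma : ∀ a b c → a ℤ.* b ℤ.* c ℤ.+ ℤ.0ℤ ≡ a ℤ.* (b ℤ.* c ℤ.+ ℤ.0ℤ)
  lemma = solve-∀
·-*-assoc c f g (suc n) =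
  trans (cong (ℤ._+_ (c ℤ.* f 0 ℤ.* g (suc n))) (·-*-assoc c (tail f) g n))
        (lemma c (f 0) (g (suc n)) ((tail f * g) n))
  where
  lemma : ∀ a b c d → a ℤ.* b ℤ.* c ℤ.+ a ℤ.* d ≡ a ℤ.* (b ℤ.* c ℤ.+ d)
  lemma = solve-∀

*-assoc : ∀ f g h → (f * g) * h ≈ f * (g * h)
*-assoc f g h zero = lemma (f 0) (g 0) (h 0)
  where
  lemma : ∀ a b c →
          (a ℤ.* b ℤ.+ ℤ.0ℤ) ℤ.* c ℤ.+ ℤ.0ℤ ≡ a ℤ.* (b ℤ.* c ℤ.+ ℤ.0ℤ) ℤ.+ ℤ.0ℤ
  lemma = solve-∀
*-assoc f g h (suc n) = begin
  k ℤ.+ ((f 0 · tail g + tail f * g) * h) n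
    ≡⟨ cong (ℤ._+_ k) (*-distribʳ-+ h (f 0 · tail g) (tail f * g) n) ⟩
  k ℤ.+ (((f 0 · tail g) * h) n ℤ.+ ((tail f * g) * h) n)
    ≡⟨ cong (ℤ._+_ k) (cong₂ ℤ._+_ (·-*-assoc (f 0) (tail g) h n) (*-assoc (tail f) g h n)) ⟩
  k ℤ.+ (f 0 ℤ.* (tail g * h) n ℤ.+ (tail f * (g * h)) n)
    ≡⟨ lemma (f 0) (g 0) (h (suc n)) ((tail g * h) n) ((tail f * (g * h)) n) ⟩
  f 0 ℤ.* (g 0 ℤ.* h (suc n) ℤ.+ (tail g * h) n) ℤ.+ (tail f * (g * h)) n ∎
  where
  open ≡-Reasoning
  k : ℤ.ℤ
  k = (f * g) 0 ℤ.* h (suc n)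
  lemma : ∀ a b c d e →
          (a ℤ.* b ℤ.+ ℤ.0ℤ) ℤ.* c ℤ.+ (a ℤ.* d ℤ.+ e) ≡ a ℤ.* (b ℤ.* c ℤ.+ d) ℤ.+ e
  lemma = solve-∀

*-zeroˡ : ∀ f → 0# * f ≈ 0#
*-zeroˡ f zero    = refl
*-zeroˡ f (suc n) = trans (ℤ.+-identityˡ _) (*-zeroˡ f n)

*-identityˡ : ∀ f → 1# * f ≈ f
*-identityˡ f zero    = trans (ℤ.+-identityʳ _) (ℤ.*-identityˡ (f 0))
*-identityˡ f (suc n) =
  trans (cong₂ ℤ._+_ (ℤ.*-identityˡ (f (suc n))) (*-zeroˡ f n)) (ℤ.+-identityʳ _)

powerSeriesRing : CommutativeRing 0ℓ 0ℓ
powerSeriesRing = record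
  { Carrier = PowerSeries
  ; _≈_     = _≈_
  ; _+_     = _+_
  ; _*_     = _*_
  ; -_      = -_
  ; 0#      = 0#
  ; 1#      = 1#
  ; isCommutativeRing = record
    { isRing = record
      { +-isAbelianGroup = Pointwise.isAbelianGroup ℕ ℤ.+-0-isAbelianGroup
      ; *-cong           = *-cong
      ; *-assoc          = *-assoc
      ; *-identity       = *-identityˡ ,
                           λ f n → trans (*-comm f 1# n) (*-identityˡ f n)
      ; distrib          = (λ f g h n → trans (*-comm f (g + h) n)
                             (trans (*-distribʳ-+ f g h n)
                               (cong₂ ℤ._+_ (*-comm g f n) (*-comm h f n)))) ,
                           *-distribʳ-+
      }
    ; *-comm = *-comm
    }
  }

private
  module ℤ[[q]] = CommutativeRing powerSeriesRing

open RingProperties ℤ[[q]].ring using (-‿distribˡ-*)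
open CommutativeMonoidProduct ℤ[[q]].*-commutativeMonoid
open CommutativeRingProperties powerSeriesRing

-- Reciprocals and quotients of series with constant term 1.

sum-tail-zero : ∀ (t : ℕ → ℤ.ℤ) {m n} → m ≤ n → (∀ {k} → m ≤ k → t k ≡ ℤ.0ℤ) →
                sum {n} (t ∘ toℕ) ≡ sum {m} (t ∘ toℕ)
sum-tail-zero t {n = zero}  z≤n       t≡0 = refl
sum-tail-zero t {n = suc n} z≤n       t≡0 =
  trans (cong₂ ℤ._+_ (t≡0 z≤n) (sum-tail-zero (t ∘ suc) (z≤n {n}) λ _ → t≡0 z≤n)) (ℤ.+-identityˡ _)
sum-tail-zero t             (s≤s m≤n) t≡0 =
  cong (ℤ._+_ (t 0)) (sum-tail-zero (t ∘ suc) m≤n (t≡0 ∘ s≤s))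

*-distribˡ-sum : ∀ f {n} (h : ℕ → PowerSeries) j →
                 (f * (λ i → sum {n} λ k → h (toℕ k) i)) j ≡ sum {n} λ k → (f * h (toℕ k)) j
*-distribˡ-sum f {zero}  h j = ℤ[[q]].zeroʳ f j
*-distribˡ-sum f {suc n} h j =
  trans (ℤ[[q]].distribˡ f (h 0) (λ i → sum {n} λ k → h (suc (toℕ k)) i) j)
        (cong (ℤ._+_ ((f * h 0) j)) (*-distribˡ-sum f {n} (h ∘ suc) j))

module _ (u : PowerSeries) (u₀≡0 : u 0 ≡ ℤ.0ℤ) where

  *-suc-zero : ∀ f n → (u * f) (suc n) ≡ (tail u * f) n
  *-suc-zero f n rewrite u₀≡0 = ℤ.+-identityˡ _

  -- Each factor `u` raises the order by at least one: coefficient `suc i` of `u * u ^ k` involves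
  -- only coefficients of `u ^ k` up to `i`, which vanish by induction.
  ^-order : ∀ {k i} → i ℕ.< k → (u ^ k) i ≡ ℤ.0ℤ
  ^-order {suc k} {zero}  _         rewrite u₀≡0 = refl
  ^-order {suc k} {suc i} (s≤s i<k) = begin
    (u * u ^ k) (suc i)   ≡⟨ *-suc-zero (u ^ k) i ⟩
    (tail u * u ^ k) i    ≡⟨ *-congʳ-≤ (tail u) i (λ j≤i → ^-order (ℕ.≤-<-trans j≤i i<k)) ⟩
    (tail u * 0#) i       ≡⟨ ℤ[[q]].zeroʳ (tail u) i ⟩
    ℤ.0ℤ                  ∎
    where open ≡-Reasoning

  -- The series of all powers of `u`, cut off in each coefficient where the powers stop
  -- contributing. For `u = 1# - f` it unfolds to `recip f`.
  geometric : PowerSeries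
  geometric n = sum {suc n} λ k → (u ^ toℕ k) n

  geometric-unfold : geometric ≈ 1# + u * geometric
  geometric-unfold zero    rewrite u₀≡0 = refl
  geometric-unfold (suc n) = begin
    -- The leading `ℤ.0ℤ` is the term `k = 0`, a positive-degree coefficient of `1#`.
    ℤ.0ℤ ℤ.+ sum {suc n} (λ k → (u * u ^ toℕ k) (suc n))
      ≡⟨ cong (ℤ._+_ ℤ.0ℤ) (sum-cong-≗ {suc n} λ k → *-suc-zero (u ^ toℕ k) n) ⟩
    ℤ.0ℤ ℤ.+ sum {suc n} (λ k → (tail u * u ^ toℕ k) n)
      ≡⟨ cong (ℤ._+_ ℤ.0ℤ) (*-distribˡ-sum (tail u) {suc n} (u ^_) n) ⟨
    ℤ.0ℤ ℤ.+ (tail u * (λ i → sum {suc n} λ k → (u ^ toℕ k) i)) n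
      -- The fixed cutoff `n` becomes the cutoff `i` of `geometric`: for `i ≤ n` the extra powers
      -- have order above `i`.
      ≡⟨ cong (ℤ._+_ ℤ.0ℤ) (*-congʳ-≤ (tail u) n λ {i} i≤n →
           sum-tail-zero (λ k → (u ^ k) i) (s≤s i≤n) ^-order) ⟩
    ℤ.0ℤ ℤ.+ (tail u * geometric) n
      ≡⟨ cong (ℤ._+_ ℤ.0ℤ) (*-suc-zero geometric n) ⟨
    ℤ.0ℤ ℤ.+ (u * geometric) (suc n) ∎
    where open ≡-Reasoning

-- Write `r` for the reciprocal. The geometric recursion `r = 1 + (1 - f) r` reads
-- `r = 1 + (r - f r)`, and cancelling `r` leaves `f r = 1`.
*-inverseʳ : ∀ f → f 0 ≡ ℤ.1ℤ → f * recip f ≈ 1#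
*-inverseʳ f f₀≡1 n = begin
  x                               ≡⟨ lemma₁ x r ⟩
  r ℤ.- (r ℤ.- x)                 ≡⟨ cong (ℤ._- (r ℤ.- x)) r≡ ⟩
  1# n ℤ.+ (r ℤ.- x) ℤ.- (r ℤ.- x) ≡⟨ lemma₂ (1# n) (r ℤ.- x) ⟩
  1# n                            ∎
  where
  open ≡-Reasoning
  r x : ℤ.ℤ
  r = recip f n
  x = (f * recip f) n
  lemma₁ : ∀ a b → a ≡ b ℤ.- (b ℤ.- a)
  lemma₁ = solve-∀
  lemma₂ : ∀ a b → a ℤ.+ b ℤ.- b ≡ a
  lemma₂ = solve-∀
  r≡ : r ≡ 1# n ℤ.+ (r ℤ.- x)
  r≡ = begin
    r                                      ≡⟨ geometric-unfold (1# - f) (cong (ℤ._-_ ℤ.1ℤ) f₀≡1) n ⟩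
    1# n ℤ.+ ((1# - f) * recip f) n        ≡⟨ cong (ℤ._+_ (1# n)) (*-distribʳ-+ (recip f) 1# (- f) n) ⟩
    1# n ℤ.+ ((1# * recip f) n ℤ.+ (- f * recip f) n)
      ≡⟨ cong (ℤ._+_ (1# n)) (cong₂ ℤ._+_ (*-identityˡ (recip f) n) (sym (-‿distribˡ-* f (recip f) n))) ⟩
    1# n ℤ.+ (r ℤ.- x)                     ∎

/-*-cancel : ∀ f {h} → h 0 ≡ ℤ.1ℤ → f / h * h ≈ f
/-*-cancel f {h} h₀≡1 = cancel-inverse f {h} {recip h} (*-inverseʳ h h₀≡1)

/-unique : ∀ {f h} k → h 0 ≡ ℤ.1ℤ → k * h ≈ f → f / h ≈ k
/-unique {f} {h} k h₀≡1 = divide {k} {f} {h} {recip h} (*-inverseʳ h h₀≡1)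

*-constant-one : ∀ f h → f 0 ≡ ℤ.1ℤ → h 0 ≡ ℤ.1ℤ → (f * h) 0 ≡ ℤ.1ℤ
*-constant-one f h f₀≡1 h₀≡1 rewrite f₀≡1 | h₀≡1 = refl

∏-constant-one : ∀ is f → (∀ i → f i 0 ≡ ℤ.1ℤ) → ∏ is f 0 ≡ ℤ.1ℤ
∏-constant-one []       f f₀≡1 = refl
∏-constant-one (i ∷ is) f f₀≡1 = *-constant-one (f i) (∏ is f) (f₀≡1 i) (∏-constant-one is f f₀≡1)

1+q^-constant-one : ∀ n .{{_ : NonZero n}} → (1# + q ^ n) 0 ≡ ℤ.1ℤ
1+q^-constant-one (suc n) = refl

1-q^-constant-one : ∀ n .{{_ : NonZero n}} → (1# - q ^ n) 0 ≡ ℤ.1ℤ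
1-q^-constant-one (suc n) = refl

-- The products in the identity and their index sets.

poch-neg : ∀ a m n → poch (- (q ^ a)) (q ^ m) n ≈ ∏[ j ∈ upTo n ] (1# + q ^ (a ℕ.+ j ℕ.* m))
poch-neg a m n = ⨀-cong (upTo n) (1+x^a*[x^m]^j q a m)

poch-pos : ∀ b m n → poch (q ^ b) (q ^ m) n ≈ ∏[ j ∈ upTo n ] (1# - q ^ (b ℕ.+ j ℕ.* m))
poch-pos b m n = ⨀-cong (upTo n) (1-x^a*[x^m]^j q b m)

odds : ℕ → List ℕ
odds = applyUpTo (λ j → 2 ℕ.* j ℕ.+ 1)

-- The hypothesis `N ≤ M` ensures that the largest removed number, 2N-1, does not exceed N+M-1.
range-↭-odds-𝓔 : ∀ {N M} → N ≤ M → range 1 (N ℕ.+ M) ↭ odds N ++ 𝓔 N M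
range-↭-odds-𝓔 {N} {M} N≤M = filter-∉-↭
  (Unique.applyUpTo⁺₁ suc (N ℕ.+ M ∸ 1) λ i<j _ → ℕ.<⇒≢ (s≤s i<j))
  (Unique.applyUpTo⁺₁ (λ j → 2 ℕ.* j ℕ.+ 1) N λ i<j _ →
    ℕ.<⇒≢ (ℕ.+-monoˡ-< 1 (ℕ.*-monoʳ-< 2 i<j)))
  odds⊆range
  where
  odds⊆range : ∀ {v} → v ∈ odds N → v ∈ range 1 (N ℕ.+ M)
  odds⊆range v∈odds with j , j<N , refl ← ∈-applyUpTo⁻ (λ j → 2 ℕ.* j ℕ.+ 1) v∈odds
    -- `range 1 (N + M)` is `applyUpTo suc (N + M ∸ 1)` by computation, so the element `suc (2 * j)`
    -- sits at position `2 * j`, which must be below `N + M ∸ 1`.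
    rewrite ℕ.+-comm (2 ℕ.* j) 1 = ∈-applyUpTo⁺ suc (ℕ.∸-monoˡ-≤ 1 bound)
    where
    open ℕ.≤-Reasoning
    lemma : ∀ j → suc (suc (2 ℕ.* j)) ≡ suc j ℕ.+ suc j
    lemma = ℕ-Solver.solve-∀
    bound : suc (suc (2 ℕ.* j)) ≤ N ℕ.+ M
    bound = begin
      suc (suc (2 ℕ.* j))  ≡⟨ lemma j ⟩
      suc j ℕ.+ suc j      ≤⟨ ℕ.+-mono-≤ j<N (ℕ.≤-trans j<N N≤M) ⟩
      N ℕ.+ M              ∎

∏-range-split : ∀ {N M} f → N ≤ M → ∏ (upTo M) f ≈ ∏ (upTo N) f * ∏ (range N M) f
∏-range-split {N} {M} f N≤M = begin
  ∏ (upTo M) f                     ≡⟨ cong (λ k → ∏ (upTo k) f) (ℕ.m+[n∸m]≡n N≤M) ⟨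
  ∏ (upTo (N ℕ.+ (M ∸ N))) f       ≡⟨ cong (λ is → ∏ is f) (applyUpTo-++ (λ j → j) N (M ∸ N)) ⟩
  ∏ (upTo N ++ range N M) f        ≈⟨ ⨀-++ (upTo N) (range N M) f ⟩
  ∏ (upTo N) f * ∏ (range N M) f   ∎
  where open SetoidReasoning ℤ[[q]].setoid

-- The factorisation, by clearing denominators.

proposition2p4 :
    (a b m N M : ℕ) .{{_ : NonZero a}} .{{_ : NonZero b}} .{{_ : NonZero m}}
    .{{_ : NonZero N}} .{{_ : NonZero M}} →
    b ∣ a → m ≡ a ℕ.+ b → N ≤ M →
    let A : ℕ → ℕ
        A j = a ℕ.+ j ℕ.* m
        B : ℕ → ℕ
        B j = b ℕ.+ j ℕ.* m
    in g a b m N M ≈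
         (∏[ j ∈ range 0 N ] R (A j) (B j)) *
         (∏[ r ∈ 𝓔 N M ] (1# + q ^ (r ℕ.* m))) *
         (∏[ j ∈ range N M ] (1# / (1# - q ^ B j)))
proposition2p4 a b m N M _ refl N≤M =
  /-unique {poch (- (q ^ m)) (q ^ m) (N ℕ.+ M ∸ 1)} {X′ * Y′} (∏R * ∏E * ∏S) X′Y′-constant-one
    (clear-denominators {∏R} {∏E} {∏S} {X′} {Y′} {∏ (upTo N) y} {∏ (range N M) y} {∏ (upTo N) n}
      Y′-split R-cleared S-cleared numerator)
  where
  A B : ℕ → ℕ
  A j = a ℕ.+ j ℕ.* m
  B j = b ℕ.+ j ℕ.* m

  x y n s F : ℕ → PowerSeries
  x j = 1# + q ^ A j
  y j = 1# - q ^ B j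
  n j = 1# + q ^ (A j ℕ.+ B j)
  s j = 1# / y j
  F r = 1# + q ^ (r ℕ.* m)

  X′ Y′ ∏R ∏E ∏S : PowerSeries
  X′ = poch (- (q ^ a)) (q ^ m) N
  Y′ = poch (q ^ b) (q ^ m) M
  ∏R = ∏[ j ∈ range 0 N ] R (A j) (B j)
  ∏E = ∏ (𝓔 N M) F
  ∏S = ∏ (range N M) s

  x-constant-one : ∀ j → x j 0 ≡ ℤ.1ℤ
  x-constant-one j = 1+q^-constant-one (A j) {{m+n≢0 a (j ℕ.* m)}}

  y-constant-one : ∀ j → y j 0 ≡ ℤ.1ℤ
  y-constant-one j = 1-q^-constant-one (B j) {{m+n≢0 b (j ℕ.* m)}}

  X′Y′-constant-one : (X′ * Y′) 0 ≡ ℤ.1ℤ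
  X′Y′-constant-one = *-constant-one X′ Y′
    (trans (poch-neg a m N 0) (∏-constant-one (upTo N) x x-constant-one))
    (trans (poch-pos b m M 0) (∏-constant-one (upTo M) y y-constant-one))

  open SetoidReasoning ℤ[[q]].setoid

  Y′-split : Y′ ≈ ∏ (upTo N) y * ∏ (range N M) y
  Y′-split = begin
    Y′                               ≈⟨ poch-pos b m M ⟩
    ∏ (upTo M) y                     ≈⟨ ∏-range-split y N≤M ⟩
    ∏ (upTo N) y * ∏ (range N M) y   ∎

  R-cleared : ∏R * (X′ * ∏ (upTo N) y) ≈ ∏ (upTo N) n
  R-cleared = begin
    ∏R * (X′ * ∏ (upTo N) y)
      ≈⟨ *-cong {∏R} {∏R} (λ _ → refl) (*-cong {X′} {g = ∏ (upTo N) y} (poch-neg a m N) λ _ → refl) ⟩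
    ∏R * (∏ (upTo N) x * ∏ (upTo N) y)
      ≈⟨ *-cong {∏R} {∏R} (λ _ → refl) (⨀-∙ (upTo N) x y) ⟩
    -- `range 0 N` computes to `upTo N`, so the products merge factor by factor and each
    -- `R (A j) (B j)` meets its own denominator.
    ∏R * ∏ (upTo N) (λ j → x j * y j)
      ≈⟨ ⨀-∙ (upTo N) (λ j → R (A j) (B j)) (λ j → x j * y j) ⟩
    ∏ (upTo N) (λ j → R (A j) (B j) * (x j * y j))
      ≈⟨ ⨀-cong (upTo N) (λ j → /-*-cancel (n j) {x j * y j}
           (*-constant-one (x j) (y j) (x-constant-one j) (y-constant-one j))) ⟩
    ∏ (upTo N) n ∎

  S-cleared : ∏S * ∏ (range N M) y ≈ 1#
  S-cleared = begin
    ∏S * ∏ (range N M) y               ≈⟨ ⨀-∙ (range N M) s y ⟩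
    ∏ (range N M) (λ j → s j * y j)    ≈⟨ ⨀-cong (range N M) (λ j → /-*-cancel 1# {y j} (y-constant-one j)) ⟩
    ∏ (range N M) (λ _ → 1#)           ≈⟨ ⨀-ε (range N M) ⟩
    1#                                 ∎

  -- This is where `m = a + b` enters: the sum is `(a + b) + 2jm`, an odd multiple of `m`.
  A+B : ∀ j → A j ℕ.+ B j ≡ (2 ℕ.* j ℕ.+ 1) ℕ.* m
  A+B j = lemma a b j
    where
    lemma : ∀ a b j → a ℕ.+ j ℕ.* (a ℕ.+ b) ℕ.+ (b ℕ.+ j ℕ.* (a ℕ.+ b)) ≡
                      (2 ℕ.* j ℕ.+ 1) ℕ.* (a ℕ.+ b)
    lemma = ℕ-Solver.solve-∀

  numerator : ∏ (upTo N) n * ∏E ≈ poch (- (q ^ m)) (q ^ m) (N ℕ.+ M ∸ 1)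
  numerator = begin
    ∏ (upTo N) n * ∏E
      ≈⟨ *-cong {g = ∏E} (⨀-cong (upTo N) (λ j i → cong (λ k → (1# + q ^ k) i) (A+B j))) (λ _ → refl) ⟩
    ∏ (upTo N) (λ j → F (2 ℕ.* j ℕ.+ 1)) * ∏E
      ≡⟨ cong (_* ∏E) (⨀-applyUpTo (λ j → 2 ℕ.* j ℕ.+ 1) N F) ⟨
    ∏ (odds N) F * ∏E
      ≈⟨ ⨀-++ (odds N) (𝓔 N M) F ⟨
    ∏ (odds N ++ 𝓔 N M) F
      ≈⟨ ⨀-↭ F (range-↭-odds-𝓔 N≤M) ⟨
    ∏ (range 1 (N ℕ.+ M)) F
      ≡⟨ ⨀-applyUpTo suc (N ℕ.+ M ∸ 1) F ⟩
    ∏ (upTo (N ℕ.+ M ∸ 1)) (F ∘ suc)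
      -- The exponents agree by computation, as `suc j * m` unfolds to `m + j * m`.
      ≈⟨ poch-neg m m (N ℕ.+ M ∸ 1) ⟨
    poch (- (q ^ m)) (q ^ m) (N ℕ.+ M ∸ 1) ∎
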